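{- The consequence relation $\vDash_{\mathcal{V}}$ over $\mathcal{V}$-BAOs is recursively axiomatizable.
   Context: A BAO is a Boolean algebra with unary operations $\Diamond$ (one for each modality of the propositional modal language considered), each preserving binary joins and $\bot$, with $\Box x=\neg\Diamond\neg x$. It validates a formula $\varphi$ (written $\mathfrak{A}\vDash\varphi$) if every assignment of elements to propositional variables, extended homomorphically, sends $\varphi$ to $\top$. A $\mathcal{V}$-BAO is a BAO in which every operator is completely additive: for every set $X$ of elements, if $\bigvee X$ exists, then $\bigvee\{\Diamond x\mid x\in X\}$ exists and equals $\Diamond\bigvee X$. For a set $\Sigma$ of modal formulas and a modal formula $\varphi$, $\Sigma\vDash_{\mathcal{V}}\varphi$ iff for every $\mathcal{V}$-BAO $\mathfrak{A}$, if $\mathfrak{A}\vDash\sigma$ for all $\sigma\in\Sigma$, then $\mathfrak{A}\vDash\varphi$. Recursive axiomatizability of a consequence relation means that it allows a decidable notion of proof: there is a decidable relation "$\pi$ is a proof of $\varphi$ from $\Sigma_0$" between finite objects $\pi$, formulas $\varphi$ and finite sets $\Sigma_0$ of formulas such that, for all $\Sigma$ and $\varphi$, $\varphi$ is a consequence of $\Sigma$ iff there is a proof of $\varphi$ from some finite $\Sigma_0\subseteq\Sigma$. -}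

module Defs where

open import Level using (Level; 0ℓ; suc; _⊔_)
open import Algebra.Core using (Op₁)
open import Algebra.Lattice.Bundles using (BooleanAlgebra)
import Algebra.Lattice.Properties.BooleanAlgebra as BooleanAlgebraProperties
open import Data.List.Base using (List)
open import Data.List.Relation.Binary.BagAndSetEquality using (_∼[_]_; set)
open import Data.List.Relation.Unary.All using (All)
open import Data.Maybe.Base using (Maybe; just)
open import Data.Nat.Base using (ℕ)
open import Data.Product.Base using (_×_; ∃-syntax)
open import Function.Bundles using (_⇔_)
open import Relation.Binary.Bundles using (Poset)
open import Relation.Binary.PropositionalEquality.Core using (_≡_)
open import Relation.Nullary.Decidable.Core using (Dec)
open import Relation.Unary using (Pred; _∈_)

-- A type of finite objects: its elements have Gödel numbers, and it is
-- decidable whether a number is one (`decode n` may fail).  Finite types and ℕ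
-- are instances.
record Coding (A : Set) : Set where
  field
    encode        : A → ℕ
    decode        : ℕ → Maybe A
    decode-encode : ∀ a → decode (encode a) ≡ just a

-- `I` is the set of modalities, and the propositional variables are p₀, p₁, ….
data Formula (I : Set) : Set where
  var   : ℕ → Formula I
  ⊥ᶠ ⊤ᶠ : Formula I
  ¬ᶠ_   : Formula I → Formula I
  _∧ᶠ_  : Formula I → Formula I → Formula I
  _∨ᶠ_  : Formula I → Formula I → Formula I
  ◇ᶠ    : I → Formula I → Formula I

_→ᶠ_ : {I : Set} → Formula I → Formula I → Formula I
φ →ᶠ ψ = (¬ᶠ φ) ∨ᶠ ψ

□ᶠ : {I : Set} → I → Formula I → Formula I
□ᶠ i φ = ¬ᶠ (◇ᶠ i (¬ᶠ φ))

-- Algebras are setoid-based, so each operator has to respect `_≈_`.  The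
-- one-element algebra is included; it validates every formula.
record BAO (I : Set) (a : Level) : Set (suc a) where
  field
    booleanAlgebra : BooleanAlgebra a a

  open BooleanAlgebra booleanAlgebra public

  field
    ◇      : I → Op₁ Carrier
    ◇-cong : ∀ i {x y} → x ≈ y → ◇ i x ≈ ◇ i y
    ◇-∨    : ∀ i x y → ◇ i (x ∨ y) ≈ ◇ i x ∨ ◇ i y
    ◇-⊥    : ∀ i → ◇ i ⊥ ≈ ⊥

  □ : I → Op₁ Carrier
  □ i x = ¬ (◇ i (¬ x))

  -- `x ≤ y` unfolds to `x ≈ x ∧ y`.
  poset : Poset a a a
  poset = BooleanAlgebraProperties.poset booleanAlgebra

  open Poset poset public using (_≤_)

  ⟦_⟧ : Formula I → (ℕ → Carrier) → Carrier
  ⟦ var p  ⟧ ρ = ρ p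
  ⟦ ⊥ᶠ     ⟧ ρ = ⊥
  ⟦ ⊤ᶠ     ⟧ ρ = ⊤
  ⟦ ¬ᶠ φ   ⟧ ρ = ¬ (⟦ φ ⟧ ρ)
  ⟦ φ ∧ᶠ ψ ⟧ ρ = ⟦ φ ⟧ ρ ∧ ⟦ ψ ⟧ ρ
  ⟦ φ ∨ᶠ ψ ⟧ ρ = ⟦ φ ⟧ ρ ∨ ⟦ ψ ⟧ ρ
  ⟦ ◇ᶠ i φ ⟧ ρ = ◇ i (⟦ φ ⟧ ρ)

  Validates : Formula I → Set a
  Validates φ = ∀ ρ → ⟦ φ ⟧ ρ ≈ ⊤

IsLub : ∀ {c ℓ₁ ℓ₂ p} (P : Poset c ℓ₁ ℓ₂) →
        Pred (Poset.Carrier P) p → Poset.Carrier P → Set (c ⊔ ℓ₂ ⊔ p)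
IsLub P X s = (∀ x → x ∈ X → x ≤ s) × (∀ u → (∀ x → x ∈ X → x ≤ u) → s ≤ u)
  where open Poset P using (_≤_)

-- `⋁ X exists` is the datum of a least upper bound `s` of `X`; the conclusion
-- says that `◇ s` is then a least upper bound of the image of `X`.
CompletelyAdditive : ∀ {I a} (𝔄 : BAO I a) → Op₁ (BAO.Carrier 𝔄) → Set (suc a)
CompletelyAdditive {_} {a} 𝔄 f =
  (X : Pred Carrier a) (s : Carrier) → IsLub poset X s →
  IsLub poset (λ y → ∃[ x ] (x ∈ X × y ≈ f x)) (f s)
  where open BAO 𝔄 using (Carrier; _≈_; poset)

IsVBAO : ∀ {I a} → BAO I a → Set (suc a)
IsVBAO {I} 𝔄 = (i : I) → CompletelyAdditive 𝔄 (BAO.◇ 𝔄 i)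

VConsequence : (I : Set) (a : Level) → Pred (Formula I) a → Formula I → Set (suc a)
VConsequence I a Σ φ =
  (𝔄 : BAO I a) → IsVBAO 𝔄 →
  (∀ σ → σ ∈ Σ → BAO.Validates 𝔄 σ) → BAO.Validates 𝔄 φ

-- Proofs are finite objects, given by their Gödel numbers.  Finite sets of
-- formulas are lists up to having the same elements, and decidability is
-- witnessed by an algorithm, namely a function into `Dec`.
record RecursivelyAxiomatizable {I : Set} {a b : Level}
         (_⊨_ : Pred (Formula I) a → Formula I → Set b) : Set (suc (a ⊔ b)) where
  field
    IsProof      : ℕ → Formula I → List (Formula I) → Set
    isProof?     : ∀ π φ Σ₀ → Dec (IsProof π φ Σ₀)
    IsProof-resp : ∀ {π φ Σ₀ Σ₁} → Σ₀ ∼[ set ] Σ₁ → IsProof π φ Σ₀ → IsProof π φ Σ₁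
    axiomatizes  : ∀ Σ φ → (Σ ⊨ φ) ⇔ (∃[ π ] ∃[ Σ₀ ] (All (_∈ Σ) Σ₀ × IsProof π φ Σ₀))

{-# OPTIONS --safe #-}

-- An operator ◇ of a Boolean algebra is completely additive iff, for all s and
-- u, the inequality ◇ s ≤ u holds as soon as s ≤ t for every t that bounds
-- {y ≤ s ∣ ◇ y ≤ u}.  The proof calculus is equational logic for BAOs over
-- terms with a further constructor τ i s u, which names such a t that is
-- generic: τ bounds the set, and s ≤ τ i s u yields ◇ i s ≤ u.  Hence the
-- algebra of terms modulo provable equality is completely additive, which is
-- completeness.  For soundness, equations are proved under every interpretation
-- of the τ's as bounds: to justify the second rule, τ i s u is reinterpreted by
-- an arbitrary bound t, and all other τ-terms that are at least as deep by ⊤,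
-- which changes neither s nor u.
module Submission where

open import Defs
open import Level using (Level; Lift; lift; lower)
open import Algebra.Lattice.Bundles using (BooleanAlgebra)
open import Algebra.Lattice.Structures.Biased
  using (isDistributiveLatticeʳʲᵐ; isBooleanAlgebraʳ)
open import Data.Empty using (⊥)
open import Data.Fin.Base using () renaming (suc to fsuc)
open import Data.Fin.Patterns
open import Data.List.Base
  using (List; []; _∷_; _++_; map; lookup; upTo; applyUpTo; concatMap; cartesianProductWith)
open import Data.List.Membership.Propositional using (lose; find)
  renaming (_∈_ to _∈ˡ_)
open import Data.List.Membership.Propositional.Properties
  using (∈-++⁺ˡ; ∈-++⁺ʳ; ∈-map⁺; ∈-upTo⁺; ∈-cartesianProductWith⁺; ∈-concatMap⁺; ∈-lookup)
open import Data.List.Relation.Binary.Subset.Propositional using (_⊆_)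
open import Data.List.Relation.Binary.Subset.Propositional.Properties using (Any-resp-⊆)
open import Data.List.Relation.Unary.All as All using (All; []; _∷_; all?)
open import Data.List.Relation.Unary.All.Properties using (++⁺)
open import Data.List.Relation.Unary.Any as Any using (Any; here; any?)
open import Data.Maybe.Base using (maybe′)
open import Data.Nat.Base using (ℕ; zero; suc; _≤_; _<_; _⊔_; s≤s)
open import Data.Nat.Properties as ℕ
  using (<⇒≤; m≤m⊔n; m≤n⊔m; m⊔n≤o⇒m≤o; m⊔n≤o⇒n≤o; _<?_)
open import Data.Product.Base using (_×_; _,_; proj₁; proj₂; ∃-syntax; uncurry)
open import Data.Product.Properties using (≡-dec)
open import Data.Sum.Base using (_⊎_; inj₁; inj₂)
open import Function.Base using (_∘_)
open import Function.Bundles using (mk⇔; module Equivalence)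
open import Relation.Binary.Definitions using (DecidableEquality)
open import Relation.Binary.PropositionalEquality
  using (_≡_; refl; sym; trans; cong; cong₂; subst)
open import Relation.Nullary using (Dec; yes; no; contradiction)
open import Relation.Nullary.Decidable using (map′; _×-dec_; _⊎-dec_)
open import Relation.Unary using (Pred; _∈_)

-- Binary trees with labelled leaves, and their finite enumeration.

data Tree : Set where
  leaf : ℕ → Tree
  node : Tree → Tree → Tree

_≟ᵀ_ : DecidableEquality Tree
leaf m ≟ᵀ leaf n = map′ (cong leaf) (λ { refl → refl }) (m ℕ.≟ n)
leaf _ ≟ᵀ node _ _ = no λ ()
node _ _ ≟ᵀ leaf _ = no λ ()
node t u ≟ᵀ node t′ u′ =
  map′ (uncurry (cong₂ node)) (λ { refl → refl , refl }) (t ≟ᵀ t′ ×-dec u ≟ᵀ u′)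

-- The index bounds leaf labels and height at once, so each list is finite and a tree lies in every
-- list from its `treeBound` on.
trees : ℕ → List Tree
trees zero    = []
trees (suc n) = map leaf (upTo (suc n)) ++ cartesianProductWith node (trees n) (trees n)

treeBound : Tree → ℕ
treeBound (leaf k)   = suc k
treeBound (node t u) = suc (treeBound t ⊔ treeBound u)

∈-trees : ∀ t {n} → treeBound t ≤ n → t ∈ˡ trees n
∈-trees (leaf k)   {suc n} k<n       = ∈-++⁺ˡ (∈-map⁺ leaf (∈-upTo⁺ k<n))
∈-trees (node t u) {suc n} (s≤s t⊔u≤n) = ∈-++⁺ʳ (map leaf (upTo (suc n)))
  (∈-cartesianProductWith⁺ node (∈-trees t (m⊔n≤o⇒m≤o _ _ t⊔u≤n))
                                (∈-trees u (m⊔n≤o⇒n≤o (treeBound t) _ t⊔u≤n)))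

-- Formulas, terms and finite substitutions.

varBound : ∀ {I} → Formula I → ℕ
varBound (var p)  = suc p
varBound ⊥ᶠ       = 0
varBound ⊤ᶠ       = 0
varBound (¬ᶠ φ)   = varBound φ
varBound (φ ∧ᶠ ψ) = varBound φ ⊔ varBound ψ
varBound (φ ∨ᶠ ψ) = varBound φ ⊔ varBound ψ
varBound (◇ᶠ i φ) = varBound φ

module Calculus (I : Set) where

  infix  8 ¬ᵗ_
  infixr 7 _∧ᵗ_
  infixr 6 _∨ᵗ_
  infix  4 _≋_ _≼_

  data Term : Set where
    varᵗ  : ℕ → Term
    ⊥ᵗ ⊤ᵗ : Term
    ¬ᵗ_   : Term → Term
    _∧ᵗ_  : Term → Term → Term
    _∨ᵗ_  : Term → Term → Term
    ◇ᵗ    : I → Term → Term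
    τ     : I → Term → Term → Term

  _[_] : Formula I → (ℕ → Term) → Term
  var p    [ θ ] = θ p
  ⊥ᶠ       [ θ ] = ⊥ᵗ
  ⊤ᶠ       [ θ ] = ⊤ᵗ
  (¬ᶠ φ)   [ θ ] = ¬ᵗ (φ [ θ ])
  (φ ∧ᶠ ψ) [ θ ] = φ [ θ ] ∧ᵗ ψ [ θ ]
  (φ ∨ᶠ ψ) [ θ ] = φ [ θ ] ∨ᵗ ψ [ θ ]
  ◇ᶠ i φ   [ θ ] = ◇ᵗ i (φ [ θ ])

  -- Substitutions are lists so that they can be coded; the default `⊥ᵗ` makes any list, of whatever
  -- length, a total substitution.
  _!_ : List Term → ℕ → Term
  []      ! _     = ⊥ᵗ
  (x ∷ θ) ! zero  = x
  (x ∷ θ) ! suc k = θ ! k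

  applyUpTo-! : ∀ (θ : ℕ → Term) {n k} → k < n → applyUpTo θ n ! k ≡ θ k
  applyUpTo-! θ {suc n} {zero}  _         = refl
  applyUpTo-! θ {suc n} {suc k} (s≤s k<n) = applyUpTo-! (θ ∘ suc) k<n

  -- All variables of `φ` lie below `varBound φ`, so the default of `!` is never reached.
  []-finite : ∀ φ θ {n} → varBound φ ≤ n → φ [ applyUpTo θ n !_ ] ≡ φ [ θ ]
  []-finite (var p)  θ h = applyUpTo-! θ h
  []-finite ⊥ᶠ       θ h = refl
  []-finite ⊤ᶠ       θ h = refl
  []-finite (¬ᶠ φ)   θ h = cong ¬ᵗ_ ([]-finite φ θ h)
  []-finite (φ ∧ᶠ ψ) θ h = cong₂ _∧ᵗ_ ([]-finite φ θ (m⊔n≤o⇒m≤o _ _ h))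
                                      ([]-finite ψ θ (m⊔n≤o⇒n≤o (varBound φ) _ h))
  []-finite (φ ∨ᶠ ψ) θ h = cong₂ _∨ᵗ_ ([]-finite φ θ (m⊔n≤o⇒m≤o _ _ h))
                                      ([]-finite ψ θ (m⊔n≤o⇒n≤o (varBound φ) _ h))
  []-finite (◇ᶠ i φ) θ h = cong (◇ᵗ i) ([]-finite φ θ h)

  -- Equations, rules and derivations.

  Equation : Set
  Equation = Term × Term

  -- `≼` copies the unfolding of `_≤_`, so that its interpretation is literally the order of the
  -- algebra.
  _≋_ _≼_ : Term → Term → Equation
  x ≋ y = x , y
  x ≼ y = x ≋ x ∧ᵗ y

  -- Rules are mere labels: a label and a list of terms determine an inference, so a search can run
  -- through the inferences.
  data Rule : Set where
    ≋-refl ≋-sym ≋-trans       : Rule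
    ∨-comm ∨-assoc ∨-cong      : Rule
    ∧-comm ∧-assoc ∧-cong      : Rule
    ∨-absorbs-∧ ∧-absorbs-∨    : Rule
    ∨-distribʳ-∧               : Rule
    ∨-complementʳ ∧-complementʳ : Rule
    ¬-cong                     : Rule
    ◇-cong ◇-∨ ◇-⊥             : I → Rule
    τ-bound τ-generic          : I → Rule

  premises : Rule → List Term → List Equation
  premises r θ = go r
    where
    x = θ ! 0
    y = θ ! 1
    z = θ ! 2
    w = θ ! 3

    go : Rule → List Equation
    go ≋-sym         = (x ≋ y) ∷ []
    go ≋-trans       = (x ≋ y) ∷ (y ≋ z) ∷ []
    go ∨-cong        = (x ≋ y) ∷ (z ≋ w) ∷ []
    go ∧-cong        = (x ≋ y) ∷ (z ≋ w) ∷ []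
    go ¬-cong        = (x ≋ y) ∷ []
    go (◇-cong i)    = (x ≋ y) ∷ []
    go (τ-bound i)   = (z ≼ x) ∷ (◇ᵗ i z ≼ y) ∷ []
    go (τ-generic i) = (x ≼ τ i x y) ∷ []
    go _             = []

  conclusion : Rule → List Term → Equation
  conclusion r θ = go r
    where
    x = θ ! 0
    y = θ ! 1
    z = θ ! 2
    w = θ ! 3

    go : Rule → Equation
    go ≋-refl        = x ≋ x
    go ≋-sym         = y ≋ x
    go ≋-trans       = x ≋ z
    go ∨-comm        = x ∨ᵗ y ≋ y ∨ᵗ x
    go ∨-assoc       = (x ∨ᵗ y) ∨ᵗ z ≋ x ∨ᵗ (y ∨ᵗ z)
    go ∨-cong        = x ∨ᵗ z ≋ y ∨ᵗ w
    go ∧-comm        = x ∧ᵗ y ≋ y ∧ᵗ x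
    go ∧-assoc       = (x ∧ᵗ y) ∧ᵗ z ≋ x ∧ᵗ (y ∧ᵗ z)
    go ∧-cong        = x ∧ᵗ z ≋ y ∧ᵗ w
    go ∨-absorbs-∧   = x ∨ᵗ (x ∧ᵗ y) ≋ x
    go ∧-absorbs-∨   = x ∧ᵗ (x ∨ᵗ y) ≋ x
    go ∨-distribʳ-∧  = (y ∧ᵗ z) ∨ᵗ x ≋ (y ∨ᵗ x) ∧ᵗ (z ∨ᵗ x)
    go ∨-complementʳ = x ∨ᵗ ¬ᵗ x ≋ ⊤ᵗ
    go ∧-complementʳ = x ∧ᵗ ¬ᵗ x ≋ ⊥ᵗ
    go ¬-cong        = ¬ᵗ x ≋ ¬ᵗ y
    go (◇-cong i)    = ◇ᵗ i x ≋ ◇ᵗ i y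
    go (◇-∨ i)       = ◇ᵗ i (x ∨ᵗ y) ≋ ◇ᵗ i x ∨ᵗ ◇ᵗ i y
    go (◇-⊥ i)       = ◇ᵗ i ⊥ᵗ ≋ ⊥ᵗ
    go (τ-bound i)   = z ≼ τ i x y
    go (τ-generic i) = ◇ᵗ i x ≼ y

  -- Validity quantifies over all assignments, hence all instances of members of `Σ`, by terms with
  -- `τ` too, are axioms.
  data _⊢_ {a} (Σ : Pred (Formula I) a) : Equation → Set a where
    axiom : ∀ {σ} → σ ∈ Σ → (θ : List Term) → Σ ⊢ (σ [ θ !_ ] ≋ ⊤ᵗ)
    infer : ∀ r θ → All (Σ ⊢_) (premises r θ) → Σ ⊢ conclusion r θ

  axiom-[] : ∀ {a} {Σ : Pred (Formula I) a} {σ} → σ ∈ Σ → ∀ θ → Σ ⊢ (σ [ θ ] ≋ ⊤ᵗ)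
  axiom-[] {Σ = Σ} {σ} σ∈Σ θ =
    subst (λ x → Σ ⊢ (x ≋ ⊤ᵗ)) ([]-finite σ θ ℕ.≤-refl) (axiom σ∈Σ (applyUpTo θ (varBound σ)))

  depth : Term → ℕ
  depth (varᵗ _)  = 0
  depth ⊥ᵗ        = 0
  depth ⊤ᵗ        = 0
  depth (¬ᵗ x)    = suc (depth x)
  depth (x ∧ᵗ y)  = suc (depth x ⊔ depth y)
  depth (x ∨ᵗ y)  = suc (depth x ⊔ depth y)
  depth (◇ᵗ i x)  = suc (depth x)
  depth (τ i s u) = suc (depth s ⊔ depth u)

  -- Soundness over completely additive algebras.

  module Soundness {a} (_≟_ : DecidableEquality Term)
                   (𝔄 : BAO I a) (isV : IsVBAO 𝔄) (ρ : ℕ → BAO.Carrier 𝔄) where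
    private module 𝔄 = BAO 𝔄
    open 𝔄 using (Carrier; ◇) renaming (_≤_ to _⊑_)
    open import Algebra.Lattice.Properties.BooleanAlgebra 𝔄.booleanAlgebra using (∧-identityʳ)

    -- The values of the `τ`-terms depend on the terms `s` and `u`, not on their values, so one
    -- `τ`-term can be changed by itself. Accordingly the calculus has no congruence rule for `τ`.
    Choice : Set a
    Choice = I → Term → Term → Carrier

    ⟦_⟧ᵗ : Term → Choice → Carrier
    ⟦ varᵗ p  ⟧ᵗ ν = ρ p
    ⟦ ⊥ᵗ      ⟧ᵗ ν = 𝔄.⊥
    ⟦ ⊤ᵗ      ⟧ᵗ ν = 𝔄.⊤
    ⟦ ¬ᵗ x    ⟧ᵗ ν = 𝔄.¬ ⟦ x ⟧ᵗ ν
    ⟦ x ∧ᵗ y  ⟧ᵗ ν = ⟦ x ⟧ᵗ ν 𝔄.∧ ⟦ y ⟧ᵗ ν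
    ⟦ x ∨ᵗ y  ⟧ᵗ ν = ⟦ x ⟧ᵗ ν 𝔄.∨ ⟦ y ⟧ᵗ ν
    ⟦ ◇ᵗ i x  ⟧ᵗ ν = ◇ i (⟦ x ⟧ᵗ ν)
    ⟦ τ i s u ⟧ᵗ ν = ν i s u

    ⟦[]⟧ : ∀ φ θ ν → ⟦ φ [ θ ] ⟧ᵗ ν ≡ 𝔄.⟦ φ ⟧ (λ p → ⟦ θ p ⟧ᵗ ν)
    ⟦[]⟧ (var p)  θ ν = refl
    ⟦[]⟧ ⊥ᶠ       θ ν = refl
    ⟦[]⟧ ⊤ᶠ       θ ν = refl
    ⟦[]⟧ (¬ᶠ φ)   θ ν = cong 𝔄.¬_ (⟦[]⟧ φ θ ν)
    ⟦[]⟧ (φ ∧ᶠ ψ) θ ν = cong₂ 𝔄._∧_ (⟦[]⟧ φ θ ν) (⟦[]⟧ ψ θ ν)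
    ⟦[]⟧ (φ ∨ᶠ ψ) θ ν = cong₂ 𝔄._∨_ (⟦[]⟧ φ θ ν) (⟦[]⟧ ψ θ ν)
    ⟦[]⟧ (◇ᶠ i φ) θ ν = cong (◇ i) (⟦[]⟧ φ θ ν)

    Bounds : I → Carrier → Carrier → Carrier → Set a
    Bounds i s u t = ∀ y → y ⊑ s → ◇ i y ⊑ u → y ⊑ t

    ⊤-bounds : ∀ i s u → Bounds i s u 𝔄.⊤
    ⊤-bounds i s u y _ _ = 𝔄.sym (∧-identityʳ y)

    Bounding : Choice → Set a
    Bounding ν = ∀ i s u → Bounds i (⟦ s ⟧ᵗ ν) (⟦ u ⟧ᵗ ν) (ν i s u)

    module Update (ν : Choice) (i : I) (s u : Term) (t : Carrier) where

      update : Choice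
      update i′ s′ u′ with depth (τ i′ s′ u′) <? depth (τ i s u)
      ... | yes _ = ν i′ s′ u′
      ... | no _ with τ i′ s′ u′ ≟ τ i s u
      ...   | yes _ = t
      -- Such a term may contain `τ i s u`, so its old value may cease to be a bound; `⊤` always is
      -- one.
      ...   | no _  = 𝔄.⊤

      update-at : update i s u ≡ t
      update-at with depth (τ i s u) <? depth (τ i s u)
      ... | yes d<d = contradiction d<d (ℕ.<-irrefl refl)
      ... | no _ with τ i s u ≟ τ i s u
      ...   | yes _ = refl
      ...   | no ≢  = contradiction refl ≢

      -- Induction on `x`: all subterms are shallower still, and `update` keeps the values of
      -- shallower `τ`-terms.
      unchanged : ∀ x → depth x < depth (τ i s u) → ⟦ x ⟧ᵗ update ≡ ⟦ x ⟧ᵗ ν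
      unchanged (varᵗ p) _ = refl
      unchanged ⊥ᵗ _ = refl
      unchanged ⊤ᵗ _ = refl
      unchanged (¬ᵗ x) h = cong 𝔄.¬_ (unchanged x (<⇒≤ h))
      unchanged (x ∧ᵗ y) h = cong₂ 𝔄._∧_
        (unchanged x (ℕ.m⊔n<o⇒m<o _ _ (<⇒≤ h))) (unchanged y (ℕ.m⊔n<o⇒n<o (depth x) _ (<⇒≤ h)))
      unchanged (x ∨ᵗ y) h = cong₂ 𝔄._∨_
        (unchanged x (ℕ.m⊔n<o⇒m<o _ _ (<⇒≤ h))) (unchanged y (ℕ.m⊔n<o⇒n<o (depth x) _ (<⇒≤ h)))
      unchanged (◇ᵗ j x) h = cong (◇ j) (unchanged x (<⇒≤ h))
      unchanged (τ i′ s′ u′) h with depth (τ i′ s′ u′) <? depth (τ i s u)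
      ... | yes _ = refl
      ... | no ≮  = contradiction h ≮

      unchanged-s : ⟦ s ⟧ᵗ update ≡ ⟦ s ⟧ᵗ ν
      unchanged-s = unchanged s (s≤s (m≤m⊔n _ _))

      unchanged-u : ⟦ u ⟧ᵗ update ≡ ⟦ u ⟧ᵗ ν
      unchanged-u = unchanged u (s≤s (m≤n⊔m (depth s) _))

      -- A shallower `τ`-term keeps its value, and so do its arguments; at `τ i s u` the arguments
      -- keep theirs and `t` is a bound by assumption; elsewhere the value is `⊤`.
      bounding : Bounding ν → Bounds i (⟦ s ⟧ᵗ ν) (⟦ u ⟧ᵗ ν) t → Bounding update
      bounding ν-bounding t-bounds i′ s′ u′ with depth (τ i′ s′ u′) <? depth (τ i s u)
      ... | yes h
        rewrite unchanged s′ (ℕ.m⊔n<o⇒m<o _ _ (<⇒≤ h))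
              | unchanged u′ (ℕ.m⊔n<o⇒n<o (depth s′) _ (<⇒≤ h)) = ν-bounding i′ s′ u′
      ... | no _ with τ i′ s′ u′ ≟ τ i s u
      ...   | yes refl rewrite unchanged-s | unchanged-u = t-bounds
      ...   | no _ = ⊤-bounds i′ _ _

    module _ {Σ : Pred (Formula I) a} (𝔄⊨Σ : ∀ σ → σ ∈ Σ → 𝔄.Validates σ) where

      -- The induction treats all bounding choices together, since `τ-generic` uses its premise at
      -- an updated choice.
      sound : ∀ {e} → Σ ⊢ e → ∀ ν → Bounding ν → ⟦ proj₁ e ⟧ᵗ ν 𝔄.≈ ⟦ proj₂ e ⟧ᵗ ν
      sound (axiom {σ} σ∈Σ θ) ν b = 𝔄.trans (𝔄.reflexive (⟦[]⟧ σ (θ !_) ν)) (𝔄⊨Σ σ σ∈Σ _)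
      sound (infer ≋-refl θ []) ν b = 𝔄.refl
      sound (infer ≋-sym θ (p ∷ [])) ν b = 𝔄.sym (sound p ν b)
      sound (infer ≋-trans θ (p ∷ q ∷ [])) ν b = 𝔄.trans (sound p ν b) (sound q ν b)
      sound (infer ∨-comm θ []) ν b = 𝔄.∨-comm _ _
      sound (infer ∨-assoc θ []) ν b = 𝔄.∨-assoc _ _ _
      sound (infer ∨-cong θ (p ∷ q ∷ [])) ν b = 𝔄.∨-cong (sound p ν b) (sound q ν b)
      sound (infer ∧-comm θ []) ν b = 𝔄.∧-comm _ _
      sound (infer ∧-assoc θ []) ν b = 𝔄.∧-assoc _ _ _
      sound (infer ∧-cong θ (p ∷ q ∷ [])) ν b = 𝔄.∧-cong (sound p ν b) (sound q ν b)
      sound (infer ∨-absorbs-∧ θ []) ν b = 𝔄.∨-absorbs-∧ _ _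
      sound (infer ∧-absorbs-∨ θ []) ν b = 𝔄.∧-absorbs-∨ _ _
      sound (infer ∨-distribʳ-∧ θ []) ν b = 𝔄.∨-distribʳ-∧ _ _ _
      sound (infer ∨-complementʳ θ []) ν b = 𝔄.∨-complementʳ _
      sound (infer ∧-complementʳ θ []) ν b = 𝔄.∧-complementʳ _
      sound (infer ¬-cong θ (p ∷ [])) ν b = 𝔄.¬-cong (sound p ν b)
      sound (infer (◇-cong i) θ (p ∷ [])) ν b = 𝔄.◇-cong i (sound p ν b)
      sound (infer (◇-∨ i) θ []) ν b = 𝔄.◇-∨ i _ _
      sound (infer (◇-⊥ i) θ []) ν b = 𝔄.◇-⊥ i
      sound (infer (τ-bound i) θ (p ∷ q ∷ [])) ν b = b i _ _ _ (sound p ν b) (sound q ν b)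
      sound (infer (τ-generic i) θ (p ∷ [])) ν b =
        -- Once `S` is the join of this set, `◇ i S` is the join of its image, which `U` bounds.
        proj₂ (isV i (λ y → y ⊑ S × ◇ i y ⊑ U) S ((λ _ → proj₁) , least)) U
          λ { _ (_ , (_ , ◇y⊑U) , ≈◇y) →
              𝔄.trans ≈◇y (𝔄.trans ◇y⊑U (𝔄.∧-cong (𝔄.sym ≈◇y) 𝔄.refl)) }
        where
        s = θ ! 0
        u = θ ! 1
        S = ⟦ s ⟧ᵗ ν
        U = ⟦ u ⟧ᵗ ν

        least : ∀ t → (∀ y → y ⊑ S × ◇ i y ⊑ U → y ⊑ t) → S ⊑ t
        -- With `τ i s u` reinterpreted as `t`, the premise `s ≼ τ i s u` reads `S ⊑ t`.
        least t h = subst (_⊑ t) unchanged-s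
          (subst (⟦ s ⟧ᵗ update ⊑_) update-at
            (sound p update (bounding b (λ y y⊑S ◇y⊑U → h y (y⊑S , ◇y⊑U)))))
          where open Update ν i s u t

      -- The constant choice `⊤` is bounding, and `φ [ varᵗ ]` contains no `τ`, so its value is that
      -- of `φ` under `ρ`.
      sound-formula : ∀ φ → Σ ⊢ (φ [ varᵗ ] ≋ ⊤ᵗ) → 𝔄.⟦ φ ⟧ ρ 𝔄.≈ 𝔄.⊤
      sound-formula φ d = 𝔄.trans (𝔄.reflexive (sym (⟦[]⟧ φ varᵗ ⊤-choice)))
        (sound d ⊤-choice (λ i _ _ → ⊤-bounds i _ _))
        where
        ⊤-choice : Choice
        ⊤-choice _ _ _ = 𝔄.⊤

  -- Completeness by the Lindenbaum algebra of terms.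

  module Lindenbaum {a} (Σ : Pred (Formula I) a) where

    termAlgebra : BooleanAlgebra a a
    termAlgebra = record
      -- Terms live at level 0 but derivations from `Σ` at level `a`; a BAO has both at the same
      -- level.
      { Carrier = Lift a Term
      ; _≈_ = λ x y → Σ ⊢ (lower x ≋ lower y)
      ; _∨_ = λ x y → lift (lower x ∨ᵗ lower y)
      ; _∧_ = λ x y → lift (lower x ∧ᵗ lower y)
      ; ¬_  = λ x → lift (¬ᵗ lower x)
      ; ⊤   = lift ⊤ᵗ
      ; ⊥   = lift ⊥ᵗ
      ; isBooleanAlgebra = isBooleanAlgebraʳ record
        { isDistributiveLattice = isDistributiveLatticeʳʲᵐ record
          { isLattice = record
            { isEquivalence = record
              { refl  = λ {x} → infer ≋-refl (lower x ∷ []) []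
              ; sym   = λ {x} {y} p → infer ≋-sym (lower x ∷ lower y ∷ []) (p ∷ [])
              ; trans = λ {x} {y} {z} p q →
                  infer ≋-trans (lower x ∷ lower y ∷ lower z ∷ []) (p ∷ q ∷ [])
              }
            ; ∨-comm  = λ x y → infer ∨-comm (lower x ∷ lower y ∷ []) []
            ; ∨-assoc = λ x y z → infer ∨-assoc (lower x ∷ lower y ∷ lower z ∷ []) []
            ; ∨-cong  = λ {x} {y} {z} {w} p q →
                infer ∨-cong (lower x ∷ lower y ∷ lower z ∷ lower w ∷ []) (p ∷ q ∷ [])
            ; ∧-comm  = λ x y → infer ∧-comm (lower x ∷ lower y ∷ []) []
            ; ∧-assoc = λ x y z → infer ∧-assoc (lower x ∷ lower y ∷ lower z ∷ []) []
            ; ∧-cong  = λ {x} {y} {z} {w} p q →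
                infer ∧-cong (lower x ∷ lower y ∷ lower z ∷ lower w ∷ []) (p ∷ q ∷ [])
            ; absorptive =
                (λ x y → infer ∨-absorbs-∧ (lower x ∷ lower y ∷ []) []) ,
                (λ x y → infer ∧-absorbs-∨ (lower x ∷ lower y ∷ []) [])
            }
          ; ∨-distribʳ-∧ = λ x y z → infer ∨-distribʳ-∧ (lower x ∷ lower y ∷ lower z ∷ []) []
          }
        ; ∨-complementʳ = λ x → infer ∨-complementʳ (lower x ∷ []) []
        ; ∧-complementʳ = λ x → infer ∧-complementʳ (lower x ∷ []) []
        ; ¬-cong = λ {x} {y} p → infer ¬-cong (lower x ∷ lower y ∷ []) (p ∷ [])
        }
      }

    termBAO : BAO I a
    termBAO = record
      { booleanAlgebra = termAlgebra
      ; ◇ = λ i x → lift (◇ᵗ i (lower x))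
      ; ◇-cong = λ i {x} {y} p → infer (◇-cong i) (lower x ∷ lower y ∷ []) (p ∷ [])
      ; ◇-∨ = λ i x y → infer (◇-∨ i) (lower x ∷ lower y ∷ []) []
      ; ◇-⊥ = λ i → infer (◇-⊥ i) [] []
      }

    open BAO termBAO using (◇; ⟦_⟧; Validates) renaming (_≤_ to _⊑_)
    private module T = BAO termBAO

    ◇-mono : ∀ i {x y} → x ⊑ y → ◇ i x ⊑ ◇ i y
    ◇-mono i {x} {y} x⊑y = T.trans (T.sym (T.∧-absorbs-∨ (◇ i x) (◇ i y)))
      (T.∧-cong T.refl (T.trans (T.sym (T.◇-∨ i x y)) (T.◇-cong i x∨y≈y)))
      where
      x∨y≈y : x T.∨ y T.≈ y
      x∨y≈y = T.trans (T.∨-comm x y) (T.trans (T.∨-cong T.refl (T.trans x⊑y (T.∧-comm x y)))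
        (T.∨-absorbs-∧ y x))

    -- Upper bound: monotonicity. Leastness: if `u` bounds the image of `X`, then `τ-bound` puts all
    -- of `X` below `τ i s u`; hence `s` is below it, and `τ-generic` gives `◇ i s ⊑ u`.
    isVBAO : IsVBAO termBAO
    isVBAO i X s (upper , least) =
      (λ { y (x , x∈X , y≈◇x) → below y≈◇x (◇-mono i (upper x x∈X)) }) ,
      λ u above → infer (τ-generic i) (lower s ∷ lower u ∷ [])
        (least (lift (τ i (lower s) (lower u)))
          (λ x x∈X → infer (τ-bound i) (lower s ∷ lower u ∷ lower x ∷ [])
            (upper x x∈X ∷ above (◇ i x) (x , x∈X , T.refl) ∷ [])) ∷ [])
      where
      below : ∀ {x y z} → x T.≈ y → y ⊑ z → x ⊑ z
      below x≈y y⊑z = T.trans x≈y (T.trans y⊑z (T.∧-cong (T.sym x≈y) T.refl))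

    ⟦⟧-[] : ∀ φ ρ → lower (⟦ φ ⟧ ρ) ≡ φ [ lower ∘ ρ ]
    ⟦⟧-[] (var p)  ρ = refl
    ⟦⟧-[] ⊥ᶠ       ρ = refl
    ⟦⟧-[] ⊤ᶠ       ρ = refl
    ⟦⟧-[] (¬ᶠ φ)   ρ = cong ¬ᵗ_ (⟦⟧-[] φ ρ)
    ⟦⟧-[] (φ ∧ᶠ ψ) ρ = cong₂ _∧ᵗ_ (⟦⟧-[] φ ρ) (⟦⟧-[] ψ ρ)
    ⟦⟧-[] (φ ∨ᶠ ψ) ρ = cong₂ _∨ᵗ_ (⟦⟧-[] φ ρ) (⟦⟧-[] ψ ρ)
    ⟦⟧-[] (◇ᶠ i φ) ρ = cong (◇ᵗ i) (⟦⟧-[] φ ρ)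

    validates-axioms : ∀ σ → σ ∈ Σ → Validates σ
    validates-axioms σ σ∈Σ ρ =
      subst (λ x → Σ ⊢ (x ≋ ⊤ᵗ)) (sym (⟦⟧-[] σ ρ)) (axiom-[] σ∈Σ (lower ∘ ρ))

    -- Validity in the term algebra, at the assignment of each variable to itself, is derivability.
    complete : ∀ φ → VConsequence I a Σ φ → Σ ⊢ (φ [ varᵗ ] ≋ ⊤ᵗ)
    complete φ Σ⊨φ = subst (λ x → Σ ⊢ (x ≋ ⊤ᵗ)) (⟦⟧-[] φ (lift ∘ varᵗ))
      (Σ⊨φ termBAO isVBAO validates-axioms (lift ∘ varᵗ))

  -- Coding of terms and decidable bounded proof search.

  module BoundedSearch (coding : Coding I) where
    open Coding coding

    toTree : Term → Tree
    toTree ⊥ᵗ        = leaf 0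
    toTree ⊤ᵗ        = leaf 1
    toTree (varᵗ p)  = node (leaf 0) (leaf p)
    toTree (¬ᵗ x)    = node (leaf 1) (toTree x)
    toTree (x ∧ᵗ y)  = node (leaf 2) (node (toTree x) (toTree y))
    toTree (x ∨ᵗ y)  = node (leaf 3) (node (toTree x) (toTree y))
    toTree (◇ᵗ i x)  = node (leaf 4) (node (leaf (encode i)) (toTree x))
    toTree (τ i s u) = node (leaf 5) (node (leaf (encode i)) (node (toTree s) (toTree u)))

    -- ⊥ᵗ is also the value at the trees that code no term.
    fromTree : Tree → Term
    fromTree (leaf 1)                   = ⊤ᵗ
    fromTree (node (leaf 0) (leaf p))   = varᵗ p
    fromTree (node (leaf 1) t)          = ¬ᵗ fromTree t
    fromTree (node (leaf 2) (node t u)) = fromTree t ∧ᵗ fromTree u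
    fromTree (node (leaf 3) (node t u)) = fromTree t ∨ᵗ fromTree u
    fromTree (node (leaf 4) (node (leaf k) t)) =
      maybe′ (λ i → ◇ᵗ i (fromTree t)) ⊥ᵗ (decode k)
    fromTree (node (leaf 5) (node (leaf k) (node t u))) =
      maybe′ (λ i → τ i (fromTree t) (fromTree u)) ⊥ᵗ (decode k)
    fromTree _                          = ⊥ᵗ

    fromTree-toTree : ∀ x → fromTree (toTree x) ≡ x
    fromTree-toTree ⊥ᵗ        = refl
    fromTree-toTree ⊤ᵗ        = refl
    fromTree-toTree (varᵗ p)  = refl
    fromTree-toTree (¬ᵗ x)    = cong ¬ᵗ_ (fromTree-toTree x)
    fromTree-toTree (x ∧ᵗ y)  = cong₂ _∧ᵗ_ (fromTree-toTree x) (fromTree-toTree y)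
    fromTree-toTree (x ∨ᵗ y)  = cong₂ _∨ᵗ_ (fromTree-toTree x) (fromTree-toTree y)
    fromTree-toTree (◇ᵗ i x)  rewrite decode-encode i = cong (◇ᵗ i) (fromTree-toTree x)
    fromTree-toTree (τ i s u) rewrite decode-encode i =
      cong₂ (τ i) (fromTree-toTree s) (fromTree-toTree u)

    -- Modalities come with a coding only, so terms are compared through their trees; `fromTree`
    -- makes `toTree` injective.
    _≟_ : DecidableEquality Term
    x ≟ y = map′ injective (cong toTree) (toTree x ≟ᵀ toTree y)
      where
      injective : toTree x ≡ toTree y → x ≡ y
      injective eq = trans (sym (fromTree-toTree x)) (trans (cong fromTree eq) (fromTree-toTree y))

    toTree* : List Term → Tree
    toTree* []      = leaf 0
    toTree* (x ∷ θ) = node (toTree x) (toTree* θ)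

    fromTree* : Tree → List Term
    fromTree* (leaf _)   = []
    fromTree* (node t u) = fromTree t ∷ fromTree* u

    fromTree*-toTree* : ∀ θ → fromTree* (toTree* θ) ≡ θ
    fromTree*-toTree* []      = refl
    fromTree*-toTree* (x ∷ θ) = cong₂ _∷_ (fromTree-toTree x) (fromTree*-toTree* θ)

    substitutions : ℕ → List (List Term)
    substitutions n = map fromTree* (trees n)

    ∈-substitutions : ∀ θ {n} → treeBound (toTree* θ) ≤ n → θ ∈ˡ substitutions n
    ∈-substitutions θ {n} h = subst (_∈ˡ substitutions n) (fromTree*-toTree* θ)
      (∈-map⁺ fromTree* (∈-trees (toTree* θ) h))

    booleanRules : List Rule
    booleanRules =
      ≋-refl ∷ ≋-sym ∷ ≋-trans ∷ ∨-comm ∷ ∨-assoc ∷ ∨-cong ∷ ∧-comm ∷ ∧-assoc ∷ ∧-cong ∷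
      ∨-absorbs-∧ ∷ ∧-absorbs-∨ ∷ ∨-distribʳ-∧ ∷ ∨-complementʳ ∷ ∧-complementʳ ∷ ¬-cong ∷ []

    modalRules : I → List Rule
    modalRules i = ◇-cong i ∷ ◇-∨ i ∷ ◇-⊥ i ∷ τ-bound i ∷ τ-generic i ∷ []

    -- There may be infinitely many modalities; those with Gödel number below `n` contribute, and
    -- numbers that code none add nothing.
    rules : ℕ → List Rule
    rules n = booleanRules ++ concatMap (maybe′ modalRules [] ∘ decode) (upTo n)

    -- Each rule is located by its position, at which `lookup` computes to it.
    ∈-rules : ∀ r → ∃[ N ] (∀ {n} → N ≤ n → r ∈ˡ rules n)
    ∈-rules r = go r
      where
      boolean : ∀ k → ∃[ N ] (∀ {n} → N ≤ n → lookup booleanRules k ∈ˡ rules n)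
      boolean k = 0 , λ _ → ∈-++⁺ˡ (∈-lookup {xs = booleanRules} k)

      modal : ∀ i k → ∃[ N ] (∀ {n} → N ≤ n → lookup (modalRules i) k ∈ˡ rules n)
      modal i k = suc (encode i) , λ h →
        ∈-++⁺ʳ booleanRules (∈-concatMap⁺ (maybe′ modalRules [] ∘ decode) (lose (∈-upTo⁺ h)
          (subst (λ m → lookup (modalRules i) k ∈ˡ maybe′ modalRules [] m)
            (sym (decode-encode i)) (∈-lookup {xs = modalRules i} k))))

      go : ∀ r → ∃[ N ] (∀ {n} → N ≤ n → r ∈ˡ rules n)
      go ≋-refl        = boolean 0F
      go ≋-sym         = boolean 1F
      go ≋-trans       = boolean 2F
      go ∨-comm        = boolean 3F
      go ∨-assoc       = boolean 4F
      go ∨-cong        = boolean 5F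
      go ∧-comm        = boolean 6F
      go ∧-assoc       = boolean 7F
      go ∧-cong        = boolean 8F
      go ∨-absorbs-∧   = boolean 9F
      go ∧-absorbs-∨   = boolean (fsuc 9F)
      go ∨-distribʳ-∧  = boolean (fsuc (fsuc 9F))
      go ∨-complementʳ = boolean (fsuc (fsuc (fsuc 9F)))
      go ∧-complementʳ = boolean (fsuc (fsuc (fsuc (fsuc 9F))))
      go ¬-cong        = boolean (fsuc (fsuc (fsuc (fsuc (fsuc 9F)))))
      go (◇-cong i)    = modal i 0F
      go (◇-∨ i)       = modal i 1F
      go (◇-⊥ i)       = modal i 2F
      go (τ-bound i)   = modal i 3F
      go (τ-generic i) = modal i 4F

    -- n bounds the height as well as the rules and substitutions that may occur, so
    -- the search is finite and the number n alone can serve as the proof.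
    mutual
      Derivable : ℕ → List (Formula I) → Equation → Set
      Derivable zero    Γ e = ⊥
      Derivable (suc n) Γ e = Any (λ θ → LastStep n Γ e θ) (substitutions n)

      LastStep : ℕ → List (Formula I) → Equation → List Term → Set
      LastStep n Γ e θ =
        Any (λ σ → e ≡ (σ [ θ !_ ] ≋ ⊤ᵗ)) Γ ⊎
        Any (λ r → e ≡ conclusion r θ × All (Derivable n Γ) (premises r θ)) (rules n)

    derivable? : ∀ n Γ e → Dec (Derivable n Γ e)
    derivable? zero    Γ e = no λ ()
    derivable? (suc n) Γ e = any? (λ θ →
      any? (λ σ → e ≟ᴱ (σ [ θ !_ ] ≋ ⊤ᵗ)) Γ ⊎-dec
      any? (λ r → e ≟ᴱ conclusion r θ ×-dec all? (derivable? n Γ) (premises r θ)) (rules n))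
      (substitutions n)
      where
      _≟ᴱ_ : DecidableEquality Equation
      _≟ᴱ_ = ≡-dec _≟_ _≟_

    -- `Γ` enters the search only through membership; hence being a proof depends only on the set of
    -- elements of the list.
    Derivable-resp-⊆ : ∀ n {Γ Δ e} → Γ ⊆ Δ → Derivable n Γ e → Derivable n Δ e
    Derivable-resp-⊆ (suc n) Γ⊆Δ = Any.map λ
      { (inj₁ p) → inj₁ (Any-resp-⊆ Γ⊆Δ p)
      ; (inj₂ p) → inj₂ (Any.map (λ { (eq , ps) → eq , All.map (Derivable-resp-⊆ n Γ⊆Δ) ps }) p)
      }

    -- Agreement of the search with derivability.

    module _ {a} {Σ : Pred (Formula I) a} where

      Derivable⇒⊢ : ∀ n {Γ e} → All (_∈ Σ) Γ → Derivable n Γ e → Σ ⊢ e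
      Derivable⇒⊢ (suc n) Γ∈Σ d with find d
      ... | θ , _ , inj₁ p with find p
      ...   | σ , σ∈Γ , refl = axiom (All.lookup Γ∈Σ σ∈Γ) θ
      Derivable⇒⊢ (suc n) Γ∈Σ d | θ , _ , inj₂ p with find p
      ...   | r , _ , refl , ps = infer r θ (All.map (Derivable⇒⊢ n Γ∈Σ) ps)

      -- Asking for all larger `n` and `Δ` lets the bounds of several premises be joined by `⊔` and
      -- `++`.
      Eventually : (ℕ → List (Formula I) → Set) → Set a
      Eventually P = ∃[ N ] ∃[ Γ ] (All (_∈ Σ) Γ × (∀ {n Δ} → N ≤ n → Γ ⊆ Δ → P n Δ))

      mutual
        ⊢⇒Derivable : ∀ {e} → Σ ⊢ e → Eventually (λ n Δ → Derivable n Δ e)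
        ⊢⇒Derivable (axiom {σ} σ∈Σ θ) =
          suc (treeBound (toTree* θ)) , σ ∷ [] , σ∈Σ ∷ [] ,
          λ { (s≤s N≤n) Γ⊆Δ →
              lose (∈-substitutions θ N≤n) (inj₁ (lose (Γ⊆Δ (here refl)) refl)) }
        ⊢⇒Derivable (infer r θ ps) with ⊢⇒Derivable* ps | ∈-rules r
        ... | N , Γ , Γ∈Σ , premises-derivable | M , r∈rules =
          -- `suc` accounts for the last step; the level below must admit its substitution, its rule
          -- and the derivations of its premises.
          suc (treeBound (toTree* θ) ⊔ (M ⊔ N)) , Γ , Γ∈Σ ,
          λ { (s≤s h) Γ⊆Δ → let M⊔N≤n = m⊔n≤o⇒n≤o (treeBound (toTree* θ)) _ h in
              lose (∈-substitutions θ (m⊔n≤o⇒m≤o _ _ h))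
                (inj₂ (lose (r∈rules (m⊔n≤o⇒m≤o M _ M⊔N≤n))
                  (refl , premises-derivable (m⊔n≤o⇒n≤o M _ M⊔N≤n) Γ⊆Δ))) }

        ⊢⇒Derivable* : ∀ {es} → All (Σ ⊢_) es → Eventually (λ n Δ → All (Derivable n Δ) es)
        ⊢⇒Derivable* [] = 0 , [] , [] , λ _ _ → []
        ⊢⇒Derivable* (p ∷ ps) with ⊢⇒Derivable p | ⊢⇒Derivable* ps
        ... | N , Γ , Γ∈Σ , d | N′ , Γ′ , Γ′∈Σ , ds =
          N ⊔ N′ , Γ ++ Γ′ , ++⁺ Γ∈Σ Γ′∈Σ ,
          λ h ⊆Δ → d (m⊔n≤o⇒m≤o _ _ h) (⊆Δ ∘ ∈-++⁺ˡ) ∷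
                   ds (m⊔n≤o⇒n≤o N _ h) (⊆Δ ∘ ∈-++⁺ʳ Γ)

corollary6p8 : (I : Set) → Coding I → (a : Level) →
    RecursivelyAxiomatizable (VConsequence I a)
corollary6p8 I coding a = record
  { IsProof      = λ π φ Γ → Derivable π Γ (φ [ varᵗ ] ≋ ⊤ᵗ)
  ; isProof?     = λ π φ Γ → derivable? π Γ (φ [ varᵗ ] ≋ ⊤ᵗ)
  ; IsProof-resp = λ {π} Γ∼Δ → Derivable-resp-⊆ π (Equivalence.to Γ∼Δ)
  ; axiomatizes  = λ Σ φ → mk⇔
      -- The threshold `N` is itself the proof, from the finitely many members `Γ` of `Σ` that the
      -- derivation uses.
      (λ Σ⊨φ → let N , Γ , Γ∈Σ , d = ⊢⇒Derivable (Lindenbaum.complete Σ φ Σ⊨φ) in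
        N , Γ , Γ∈Σ , d ℕ.≤-refl (λ σ∈Γ → σ∈Γ))
      (λ { (π , Γ , Γ∈Σ , d) 𝔄 isV 𝔄⊨Σ ρ →
        Soundness.sound-formula _≟_ 𝔄 isV ρ 𝔄⊨Σ φ (Derivable⇒⊢ π Γ∈Σ d) })
  }
  where
  open Calculus I
  open BoundedSearch coding
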